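{- Suppose $\kappa$ is a strongly inaccessible cardinal which is not Mahlo and $\diamondsuit_\kappa$ holds. Let $b\in\mathcal{R}^+_\kappa$. Then $$\mathfrak{d}_\kappa(\le^*)\ \le\ \mathfrak{d}^{b,\mathrm{id}^+}_\kappa(\not\ni^\infty)\ \le\ \mathfrak{d}^{b,b}_\kappa(\not\ni^\infty)\ =\ \mathfrak{d}^b_\kappa(\le^*).$$
   Context: $\mathcal{R}^+_\kappa$ is the set of all strictly increasing $b\in{}^\kappa\kappa$ such that each $b(\alpha)\geq 3$ is an infinite regular cardinal and $\alpha<b(\alpha)$ for every $\alpha<\kappa$. $\mathrm{id}^+$ is the function $\mathrm{id}^+(\alpha)=|\alpha|^+$, so slaloms of width $<\mathrm{id}^+$ satisfy $|\varphi(\alpha)|\le|\alpha|$. For a function $h$ on $\kappa$ with cardinal values, $h\le b$, put $\mathrm{Loc}^{b,h}_\kappa=\prod_{\alpha<\kappa}[b(\alpha)]^{<h(\alpha)}$. For $\varphi\in\mathrm{Loc}^{b,h}_\kappa$ and $f\in\prod_{\alpha<\kappa}b(\alpha)$, $\varphi\not\ni^\infty f$ means that there is $\alpha<\kappa$ with $f(\beta)\notin\varphi(\beta)$ for all $\beta\ge\alpha$; and $\mathfrak{d}^{b,h}_\kappa(\not\ni^\infty)$ is the least size of $\mathcal G\subseteq\prod_{\alpha<\kappa}b(\alpha)$ such that for every $\varphi\in\mathrm{Loc}^{b,h}_\kappa$ there is $f\in\mathcal G$ with $\varphi\not\ni^\infty f$. $f\le^* g$ means $f(\beta)\le g(\beta)$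 for all $\beta$ from some point $\alpha<\kappa$ on. $\mathfrak{d}_\kappa(\le^*)$ is the least size of $\mathcal G\subseteq{}^\kappa\kappa$ such that every $f\in{}^\kappa\kappa$ is $\le^*$ some $g\in\mathcal G$; $\mathfrak{d}^b_\kappa(\le^*)$ is the same with ${}^\kappa\kappa$ replaced in both places by $\prod_{\alpha<\kappa}b(\alpha)$. -}

module Defs where

-- ExcludedMiddle decides arbitrary types, not only propositions, so it yields a
-- choice function for every family of nonempty types. Together with
-- Extensionality it plays the role of the classical logic and choice of ZFC.
open import Axiom.ExcludedMiddle public using (ExcludedMiddle)
open import Axiom.Extensionality.Propositional public using (Extensionality)
open import Data.Bool using (Bool; true)
open import Data.Fin using (Fin)
open import Data.Nat using (ℕ)
open import Data.Product using (∃; ∃-syntax; Σ-syntax; _×_; proj₁)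
open import Function.Bundles using (Injection; Bijection)
open import Induction.WellFounded using (WellFounded)
open import Level using (Level; suc; _⊔_)
open import Relation.Binary using (Rel; Setoid; IsStrictTotalOrder)
open import Relation.Binary.Construct.On as On using ()
import Relation.Binary.Construct.StrictToNonStrict as StrictToNonStrict
open import Relation.Binary.PropositionalEquality using (_≡_; setoid)
open import Relation.Nullary using (¬_)
open import Relation.Unary using (Pred; U; _∈_; _∉_; _⊆_; _∩_; _≐_)

private
  variable
    a b p ℓ₁ ℓ₂ : Level

infix 4 _≼_ _≺_ _≈_

_≼_ : Setoid a ℓ₁ → Setoid b ℓ₂ → Set (a ⊔ ℓ₁ ⊔ b ⊔ ℓ₂)
X ≼ Y = Injection X Y

_≈_ : Setoid a ℓ₁ → Setoid b ℓ₂ → Set (a ⊔ ℓ₁ ⊔ b ⊔ ℓ₂)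
X ≈ Y = Bijection X Y

_≺_ : Setoid a ℓ₁ → Setoid b ℓ₂ → Set (a ⊔ ℓ₁ ⊔ b ⊔ ℓ₂)
X ≺ Y = X ≼ Y × ¬ (Y ≼ X)

-- The size of a subset. Elements are compared by their first components only,
-- because a predicate may have several proofs at the same point.
∣_∣ : {A : Set a} → Pred A p → Setoid (a ⊔ p) a
∣_∣ {A = A} P = On.setoid {B = ∃ P} (setoid A) proj₁

-- A cardinal is represented by any setoid 𝔡 of that size, so a least size is
-- determined up to ≈.
IsLeastSize : {A : Set a} → (Pred A a → Set p) → Setoid a a → Set (suc a ⊔ p)
IsLeastSize {a = a} {A = A} Φ 𝔡 =
  (∃[ G ] Φ G × 𝔡 ≈ ∣ G ∣) × (∀ (G : Pred A a) → Φ G → 𝔡 ≼ ∣ G ∣)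

record WellOrder ℓ : Set (suc ℓ) where
  infix 4 _<_
  field
    Carrier            : Set ℓ
    _<_                : Rel Carrier ℓ
    isStrictTotalOrder : IsStrictTotalOrder _≡_ _<_
    wellFounded        : WellFounded _<_

-- The ordinal κ is given as a well-ordered set, whose elements are the ordinals
-- below κ. An ordinal at most κ is identified with the set of its predecessors,
-- an initial segment S of κ: either U (that is, κ itself) or ↓ α with α < κ.
module OrdinalsBelow {ℓ} (κ : WellOrder ℓ) where

  open WellOrder κ public renaming (Carrier to K)
  open StrictToNonStrict _≡_ _<_ public using (_≤_)

  ↓_ : K → Pred K ℓ
  (↓ α) ξ = ξ < α

  IsCardinal : Pred K p → Set (ℓ ⊔ p)
  IsCardinal S = ∀ α → α ∈ S → ¬ (∣ ↓ α ∣ ≈ ∣ S ∣)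

  -- The map α → S is the restriction of f to the ordinals below α.
  Cofinal : K → Pred K p → (K → K) → Set (ℓ ⊔ p)
  Cofinal α S f =
    (∀ ξ → ξ < α → f ξ ∈ S) × (∀ β → β ∈ S → ∃[ ξ ] ξ < α × β ≤ f ξ)

  record IsRegularCardinal (S : Pred K p) : Set (ℓ ⊔ p) where
    field
      infinite     : setoid ℕ ≼ ∣ S ∣
      isCardinal   : IsCardinal S
      noCofinalMap : ∀ α → α ∈ S → ∀ f → ¬ Cofinal α S f

  -- The power set of α, as the set of characteristic functions supported below α.
  𝒫 : K → Pred (K → Bool) ℓ
  𝒫 α χ = ∀ ξ → χ ξ ≡ true → ξ < α

  record IsStronglyInaccessible : Set ℓ where
    field
      regular     : IsRegularCardinal (U {A = K})
      uncountable : setoid ℕ ≺ ∣ U {A = K} ∣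
      strongLimit : ∀ α → ∣ 𝒫 α ∣ ≺ ∣ U {A = K} ∣

  -- The condition ξ < η < α makes α a limit in closed.
  record IsClub (C : Pred K ℓ) : Set ℓ where
    field
      unbounded : ∀ ξ → ∃[ η ] ξ < η × η ∈ C
      closed    : ∀ α → (∃[ ξ ] ξ < α) →
                  (∀ ξ → ξ < α → ∃[ η ] ξ < η × η < α × η ∈ C) → α ∈ C

  IsStationary : Pred K ℓ → Set (suc ℓ)
  IsStationary S = ∀ C → IsClub C → ∃[ α ] α ∈ C × α ∈ S

  IsMahlo : Set (suc ℓ)
  IsMahlo =
    IsStronglyInaccessible × IsStationary (λ α → IsRegularCardinal (↓ α))

  Diamond : Set (suc ℓ)
  Diamond = Σ[ A ∈ (K → Pred K ℓ) ]
              (∀ α → A α ⊆ ↓ α) ×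
              (∀ (X : Pred K ℓ) → IsStationary (λ α → X ∩ ↓ α ≐ A α))

  IsSuccessorCardinal : K → K → Set ℓ
  IsSuccessorCardinal α γ =
    (IsCardinal (↓ γ) × ∣ ↓ α ∣ ≺ ∣ ↓ γ ∣) ×
    (∀ δ → IsCardinal (↓ δ) → ∣ ↓ α ∣ ≺ ∣ ↓ δ ∣ → γ ≤ δ)

  record R⁺ (b : K → K) : Set ℓ where
    field
      strictlyIncreasing : ∀ α β → α < β → b α < b β
      atLeast3           : ∀ α → setoid (Fin 3) ≼ ∣ ↓ b α ∣
      regular            : ∀ α → IsRegularCardinal (↓ b α)
      aboveId            : ∀ α → α < b α

  ∏ : (K → K) → Pred (K → K) ℓ
  ∏ b f = ∀ α → f α < b α

  Loc : (b h : K → K) → Pred (K → Pred K ℓ) ℓ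
  Loc b h φ = ∀ α → φ α ⊆ ↓ b α × ∣ φ α ∣ ≺ ∣ ↓ h α ∣

  infix 4 _∌^∞_ _≤*_

  _∌^∞_ : (K → Pred K ℓ) → (K → K) → Set ℓ
  φ ∌^∞ f = ∃[ α ] ∀ β → α ≤ β → f β ∉ φ β

  _≤*_ : (K → K) → (K → K) → Set ℓ
  f ≤* g = ∃[ α ] ∀ β → α ≤ β → f β ≤ g β

  AntiLocalizing : (b h : K → K) → Pred (K → K) ℓ → Set (suc ℓ)
  AntiLocalizing b h 𝒢 =
    𝒢 ⊆ ∏ b × (∀ φ → φ ∈ Loc b h → ∃[ f ] f ∈ 𝒢 × φ ∌^∞ f)

  Dominating : Pred (K → K) p → Pred (K → K) ℓ → Set (ℓ ⊔ p)
  Dominating X 𝒢 = 𝒢 ⊆ X × (∀ f → f ∈ X → ∃[ g ] g ∈ 𝒢 × f ≤* g)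

  Is𝔡≤* : Setoid ℓ ℓ → Set (suc ℓ)
  Is𝔡≤* = IsLeastSize (Dominating (U {A = K → K}))

  IsBounded𝔡≤* : (K → K) → Setoid ℓ ℓ → Set (suc ℓ)
  IsBounded𝔡≤* b = IsLeastSize (Dominating (∏ b))

  Is𝔡∌^∞ : (b h : K → K) → Setoid ℓ ℓ → Set (suc ℓ)
  Is𝔡∌^∞ b h = IsLeastSize (AntiLocalizing b h)

{-# OPTIONS --safe #-}
-- For slaloms of width b, avoiding φ(α) is the same as bounding it, because b(α)
-- is regular; and slaloms of width < id⁺ have width < b.
-- For 𝔡_κ(≤*), fix a club C of singular limit ordinals and a ◇-sequence guessing
-- functions. For γ < δ there is a regressive map r from C ∩ (γ, δ) into (γ, δ)
-- whose fibre over each α has size at most |α|; this is where the absence of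
-- regular elements of C enters, by induction on δ. Given f, cut κ into intervals
-- closed under f and let φ(α) consist of the values at α guessed at those β in the
-- interval of α with r(β) = α. If g is guessed correctly at some β in C between η
-- and f(η), then g(α) ∈ φ(α) for α = r(β). So if φ is eventually avoided by g,
-- then f is ≤* any function sending η to a point of C above η at which g is guessed.
module Submission where

open import Defs
open import Data.Empty using (⊥; ⊥-elim)
open import Data.Nat as ℕ using (ℕ)
import Data.Nat.Properties as ℕₚ
open import Data.Product using (_×_; _,_; ∃; ∃-syntax; Σ-syntax; proj₁; proj₂; curry)
open import Data.Product.Relation.Binary.Lex.Strict using (×-Lex; ×-compare; ×-wellFounded)
open import Data.Sum using (_⊎_; inj₁; inj₂)
open import Function.Bundles using (Injection; Bijection)
open import Function.Construct.Composition using () renaming (injection to ≼-trans)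
open import Function.Properties.Bijection using (Bijection⇒Inverse)
open import Function.Properties.Inverse using (Inverse⇒Injection) renaming (sym to ↔-sym)
open import Induction.WellFounded using (WellFounded; WfRec; module All; module FixPoint; module Subrelation)
open import Level using (Level; Lift; _⊔_)
open import Relation.Binary using (Rel; Setoid; IsStrictTotalOrder; tri<; tri≈; tri>)
import Relation.Binary.Construct.On as On
open import Relation.Binary.PropositionalEquality using (_≡_; refl; sym; trans; cong; subst; subst₂; setoid)
open import Relation.Nullary using (¬_; Dec; yes; no; contradiction)
open import Relation.Nullary.Decidable using (decidable-stable)
open import Relation.Unary using (Pred; U; _∈_; _∉_; _⊆_)

private
  variable
    a b c d p q ℓ₁ ℓ₂ : Level

-- Comparing least sizes

≈⇒≽ : {X : Setoid a ℓ₁} {Y : Setoid b ℓ₂} → X ≈ Y → Y ≼ X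
≈⇒≽ X≈Y = Inverse⇒Injection (↔-sym (Bijection⇒Inverse X≈Y))

⊆⇒≼ : {A : Set a} {P : Pred A p} {Q : Pred A q} → P ⊆ Q → ∣ P ∣ ≼ ∣ Q ∣
⊆⇒≼ P⊆Q = record
  { to        = λ (x , x∈P) → x , P⊆Q x∈P
  ; cong      = λ x≡y → x≡y
  ; injective = λ x≡y → x≡y
  }

leastSize-≼ : {A : Set a} {Φ : Pred A a → Set p} {Ψ : Pred A a → Set q} {𝔡 𝔢 : Setoid a a} →
              (∀ G → Φ G → ∃[ H ] Ψ H × ∣ H ∣ ≼ ∣ G ∣) →
              IsLeastSize Φ 𝔡 → IsLeastSize Ψ 𝔢 → 𝔢 ≼ 𝔡
leastSize-≼ Φ⇒Ψ ((G , ΦG , 𝔡≈G) , _) (_ , 𝔢-least) =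
  let H , ΨH , H≼G = Φ⇒Ψ G ΦG
  in ≼-trans (𝔢-least H ΨH) (≼-trans H≼G (≈⇒≽ 𝔡≈G))

leastSize-antitone : {A : Set a} {Φ : Pred A a → Set p} {Ψ : Pred A a → Set q} {𝔡 𝔢 : Setoid a a} →
                     (∀ G → Φ G → Ψ G) →
                     IsLeastSize Φ 𝔡 → IsLeastSize Ψ 𝔢 → 𝔢 ≼ 𝔡
leastSize-antitone Φ⇒Ψ =
  leastSize-≼ (λ G ΦG → G , Φ⇒Ψ G ΦG , ⊆⇒≼ (λ x∈G → x∈G))

-- Classical choice, and injections from relations

module Classical (em : ∀ {a} → ExcludedMiddle a) where

  abstract
    byContradiction : {P : Set a} → ¬ ¬ P → P
    byContradiction = decidable-stable em

  private
    pick : {A : Set a} → Dec A → A → A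
    pick (yes x) _ = x
    pick (no ¬x) x = contradiction x ¬x

    pick-constant : {A : Set a} (A? : Dec A) (x y : A) → pick A? x ≡ pick A? y
    pick-constant (yes _) _ _ = refl
    pick-constant (no ¬x) x _ = contradiction x ¬x

  -- The element is picked by `em` from the type alone; the argument only excludes the empty case.
  -- Constructions that carry a membership proof thus become independent of that proof.
  chosen : {A : Set a} → A → A
  chosen = pick em

  chosen-constant : {A : Set a} (x y : A) → chosen x ≡ chosen y
  chosen-constant = pick-constant em

  -- `total` may give different images for different proofs of `x ∈ P`, which `∣_∣` identifies.
  -- Passing through `chosen` makes the map respect this.
  relation-≼ : {A : Set a} {B : Set b} {P : Pred A p} {Q : Pred B q} (R : A → B → Set c) →
               (∀ {x} → x ∈ P → ∃[ y ] y ∈ Q × R x y) →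
               (∀ {x x′ y} → R x y → R x′ y → x ≡ x′) →
               ∣ P ∣ ≼ ∣ Q ∣
  relation-≼ {P = P} {Q} R total inj = record
    { to        = λ (x , x∈P) → let y , y∈Q , _ = image x∈P in y , y∈Q
    ; cong      = λ { {x , s} {.x , t} refl → cong proj₁ (chosen-constant (total s) (total t)) }
    ; injective = λ { {x , s} {x′ , t} y≡y′ →
                      inj (proj₂ (proj₂ (image s)))
                          (subst (R x′) (sym y≡y′) (proj₂ (proj₂ (image t)))) }
    }
    where
    image : ∀ {x} → x ∈ P → ∃[ y ] y ∈ Q × R x y
    image x∈P = chosen (total x∈P)

  image-≼ : {A : Set a} {B : Set b} {P : Pred A p} (F : A → B) →
            ∣ (λ y → ∃[ x ] x ∈ P × F x ≡ y) ∣ ≼ ∣ P ∣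
  image-≼ F = relation-≼ (λ y x → F x ≡ y) (λ y∈F[P] → y∈F[P]) λ where refl eq → eq

  -- The Schröder-Bernstein theorem

  module _ {X : Setoid a ℓ₁} {Y : Setoid b ℓ₂} (f : X ≼ Y) (g : Y ≼ X) where
    private
      module X = Setoid X
      module Y = Setoid Y
      module f = Injection f
      module g = Injection g

      -- The points reached from outside the range of `g` by iterating `g` after `f`. The bijection
      -- follows `f` on them and the inverse of `g` elsewhere.
      data FromX : X.Carrier → Set (a ⊔ b ⊔ ℓ₁) where
        origin : ∀ {x} → (∀ y → ¬ g.to y X.≈ x) → FromX x
        step   : ∀ {x x′} → FromX x → g.to (f.to x) X.≈ x′ → FromX x′

      FromX-resp : ∀ {x x′} → x X.≈ x′ → FromX x → FromX x′
      FromX-resp x≈x′ (origin ∉g) = origin λ y gy≈x′ → ∉g y (X.trans gy≈x′ (X.sym x≈x′))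
      FromX-resp x≈x′ (step s eq) = step s (X.trans eq x≈x′)

      _↦_ : X.Carrier → Y.Carrier → Set (a ⊔ b ⊔ ℓ₁ ⊔ ℓ₂)
      x ↦ y = (FromX x × f.to x Y.≈ y) ⊎ (¬ FromX x × g.to y X.≈ x)

      ↦-total : ∀ x → ∃ (x ↦_)
      ↦-total x with em {P = FromX x}
      ... | yes s = f.to x , inj₁ (s , Y.refl)
      ... | no ¬s =
        let y , gy≈x = byContradiction λ ∉g → ¬s (origin λ y gy≈x → ∉g (y , gy≈x))
        in y , inj₂ (¬s , gy≈x)

      ↦-functional : ∀ {x x′ y y′} → x X.≈ x′ → x ↦ y → x′ ↦ y′ → y Y.≈ y′
      ↦-functional x≈x′ (inj₁ (_ , eq)) (inj₁ (_ , eq′)) =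
        Y.trans (Y.sym eq) (Y.trans (f.cong x≈x′) eq′)
      ↦-functional x≈x′ (inj₁ (s , _)) (inj₂ (¬s , _)) = contradiction (FromX-resp x≈x′ s) ¬s
      ↦-functional x≈x′ (inj₂ (¬s , _)) (inj₁ (s , _)) =
        contradiction (FromX-resp (X.sym x≈x′) s) ¬s
      ↦-functional x≈x′ (inj₂ (_ , eq)) (inj₂ (_ , eq′)) =
        g.injective (X.trans eq (X.trans x≈x′ (X.sym eq′)))

      ↦-injective : ∀ {x x′ y y′} → y Y.≈ y′ → x ↦ y → x′ ↦ y′ → x X.≈ x′
      ↦-injective y≈y′ (inj₁ (_ , eq)) (inj₁ (_ , eq′)) =
        f.injective (Y.trans eq (Y.trans y≈y′ (Y.sym eq′)))
      ↦-injective y≈y′ (inj₁ (s , eq)) (inj₂ (¬s , eq′)) =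
        contradiction (step s (X.trans (g.cong (Y.trans eq y≈y′)) eq′)) ¬s
      ↦-injective y≈y′ (inj₂ (¬s , eq)) (inj₁ (s , eq′)) =
        contradiction (step s (X.trans (g.cong (Y.trans eq′ (Y.sym y≈y′))) eq)) ¬s
      ↦-injective y≈y′ (inj₂ (_ , eq)) (inj₂ (_ , eq′)) =
        X.trans (X.sym eq) (X.trans (g.cong y≈y′) eq′)

      ↦-surjective : ∀ y → ∃ (_↦ y)
      ↦-surjective y with em {P = FromX (g.to y)}
      ... | yes (origin ∉g)       = contradiction X.refl (∉g y)
      ... | yes (step {x} s gfx≈) = x , inj₁ (s , g.injective gfx≈)
      ... | no ¬s                 = g.to y , inj₂ (¬s , X.refl)

    schröderBernstein : X ≈ Y
    schröderBernstein = record
      { to        = λ x → proj₁ (↦-total x)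
      ; cong      = λ {x} {x′} x≈x′ →
                      ↦-functional x≈x′ (proj₂ (↦-total x)) (proj₂ (↦-total x′))
      ; bijective =
            (λ {x} {x′} y≈y′ → ↦-injective y≈y′ (proj₂ (↦-total x)) (proj₂ (↦-total x′)))
          , λ y → let x , x↦y = ↦-surjective y in
                  x , λ {z} z≈x → ↦-functional z≈x (proj₂ (↦-total z)) x↦y
      }

  -- Strictly monotone maps by well-founded recursion

  module _ (ext : ∀ {a b} → Extensionality a b)
           {W : Set a} {Y : Set b} {_≺_ : Rel W c} {_⊏_ : Rel Y d} (wf : WellFounded _≺_)
           (y₀ : Y) (above : ∀ w (u : W → Y) → ∃[ y ] (∀ {v} → v ≺ w → u v ⊏ y))
           where
    private
      -- `above` expects a total function, while the recursion supplies values only at the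
      -- predecessors of `w`. The default `y₀` elsewhere is harmless, since `above` speaks of
      -- predecessors only.
      extend : ∀ w → WfRec _≺_ (λ _ → Y) w → W → Y
      extend w u v with em {P = v ≺ w}
      ... | yes v≺w = u v≺w
      ... | no _    = y₀

      extend-≡ : ∀ w (f : W → Y) {v} → v ≺ w → extend w (λ {v} _ → f v) v ≡ f v
      extend-≡ w f {v} v≺w with em {P = v ≺ w}
      ... | yes _  = refl
      ... | no v⊀w = contradiction v≺w v⊀w

      body : ∀ w → WfRec _≺_ (λ _ → Y) w → Y
      body w u = proj₁ (above w (extend w u))

      body-ext : ∀ w {u u′ : WfRec _≺_ (λ _ → Y) w} →
                 (∀ {v} v≺w → u {v} v≺w ≡ u′ v≺w) → body w u ≡ body w u′
      body-ext w {u} {u′} u≡u′ = cong (λ g → body w (λ {v} → g v)) (ext λ v → ext (u≡u′ {v}))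

      f : W → Y
      f = All.wfRec wf _ (λ _ → Y) body

    abstract
      -- The value at `w` is the bound that `above` gives for the earlier values. Extensionality
      -- enters through the unfolding of the recursion.
      monotoneMap : Σ[ f ∈ (W → Y) ] (∀ {v w} → v ≺ w → f v ⊏ f w)
      monotoneMap = f , λ {v} {w} v≺w →
        subst₂ _⊏_ (extend-≡ w f v≺w)
               (sym (FixPoint.unfold-wfRec wf (λ _ → Y) body body-ext))
               (proj₂ (above w (extend w (λ {v} _ → f v))) v≺w)

  -- Order and size of initial segments

  module Ordinals {ℓ} (κ : WellOrder ℓ) where

    open OrdinalsBelow κ
    open IsStrictTotalOrder isStrictTotalOrder using (compare; irrefl) renaming (trans to <-trans)

    private
      variable
        α β γ ξ : K

    <-≤-trans : α < β → β ≤ γ → α < γ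
    <-≤-trans α<β (inj₁ β<γ)  = <-trans α<β β<γ
    <-≤-trans α<β (inj₂ refl) = α<β

    ≤-<-trans : α ≤ β → β < γ → α < γ
    ≤-<-trans (inj₁ α<β)  β<γ = <-trans α<β β<γ
    ≤-<-trans (inj₂ refl) β<γ = β<γ

    ≤-trans : α ≤ β → β ≤ γ → α ≤ γ
    ≤-trans α≤β (inj₁ β<γ)  = inj₁ (≤-<-trans α≤β β<γ)
    ≤-trans α≤β (inj₂ refl) = α≤β

    <⇒≱ : α < β → ¬ (β ≤ α)
    <⇒≱ α<β β≤α = irrefl refl (<-≤-trans α<β β≤α)

    ≮⇒≥ : ¬ (α < β) → β ≤ α
    ≮⇒≥ {α} {β} α≮β with compare α β
    ... | tri< α<β _ _ = contradiction α<β α≮β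
    ... | tri≈ _ eq _  = inj₂ (sym eq)
    ... | tri> _ _ β<α = inj₁ β<α

    ≰⇒> : ¬ (α ≤ β) → β < α
    ≰⇒> {α} {β} α≰β with compare α β
    ... | tri< α<β _ _ = contradiction (inj₁ α<β) α≰β
    ... | tri≈ _ eq _  = contradiction (inj₂ eq) α≰β
    ... | tri> _ _ β<α = β<α

    ≤-antisym : α ≤ β → β ≤ α → α ≡ β
    ≤-antisym (inj₁ α<β) β≤α = contradiction β≤α (<⇒≱ α<β)
    ≤-antisym (inj₂ eq)  _   = eq

    least : {P : Pred K p} → ∃ P → ∃[ α ] α ∈ P × (∀ β → β ∈ P → α ≤ β)
    least {P = P} (α , α∈P) = byContradiction λ none →
      All.wfRec wellFounded _ (λ α → α ∉ P)
        (λ α IH α∈P → none (α , α∈P , λ β β∈P → ≮⇒≥ λ β<α → IH β<α β∈P)) α α∈P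

    regular⇒bounded : {S : Pred K p} → IsRegularCardinal S →
                      ∀ {α} → α ∈ S → ∀ f → (∀ ξ → ξ < α → f ξ ∈ S) →
                      ∃[ β ] β ∈ S × (∀ ξ → ξ < α → f ξ < β)
    regular⇒bounded reg α∈S f f∈S = byContradiction λ none →
      IsRegularCardinal.noCofinalMap reg _ α∈S f
        (f∈S , λ β β∈S → byContradiction λ ∄ξ →
          none (β , β∈S , λ ξ ξ<α → ≰⇒> λ β≤fξ → ∄ξ (ξ , ξ<α , β≤fξ)))

    initial-≼ : α ≤ β → ∣ ↓ α ∣ ≼ ∣ ↓ β ∣
    initial-≼ α≤β = ⊆⇒≼ λ ξ<α → <-≤-trans ξ<α α≤β

    initial-≺ : IsCardinal (↓ β) → α < β → ∣ ↓ α ∣ ≺ ∣ ↓ β ∣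
    initial-≺ card α<β =
        initial-≼ (inj₁ α<β)
      , λ β≼α → card _ α<β (schröderBernstein (initial-≼ (inj₁ α<β)) β≼α)

    <-preserving⇒injective : (e : K → K) {S : Pred K p} →
                             (∀ {ξ η} → ξ < η → η ∈ S → e ξ < e η) →
                             ∀ {ξ η} → ξ ∈ S → η ∈ S → e ξ ≡ e η → ξ ≡ η
    <-preserving⇒injective e mono {ξ} {η} ξ∈S η∈S eq with compare ξ η
    ... | tri< ξ<η _ _ = ⊥-elim (irrefl eq (mono ξ<η η∈S))
    ... | tri≈ _ ξ≡η _ = ξ≡η
    ... | tri> _ _ η<ξ = ⊥-elim (irrefl (sym eq) (mono η<ξ ξ∈S))

    -- Small and unbounded subsets of a regular cardinal

    module _ (ext : ∀ {a b} → Extensionality a b)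
             {β : K} (β-regular : IsRegularCardinal (↓ β))
             {T : Pred K ℓ} (T⊆β : T ⊆ ↓ β)
             where

      -- Members of `T` are chosen in increasing order in `β` steps: regularity bounds the earlier
      -- choices below `β`, and unboundedness supplies a member of `T` above that bound.
      unbounded⇒≽ : (∀ α → α < β → ∃[ τ ] τ ∈ T × α ≤ τ) → ∣ ↓ β ∣ ≼ ∣ T ∣
      unbounded⇒≽ unbounded = record
        { to        = λ (ξ , _) → e ξ
        ; cong      = λ { {ξ , _} refl → refl }
        ; injective = λ { {_ , ξ<β} {_ , η<β} →
            <-preserving⇒injective (λ ξ → proj₁ (e ξ)) (λ ξ<η η<β → e-mono (ξ<η , η<β)) ξ<β η<β }
        }
        where
        τ₀ : ∃ T
        τ₀ = let α , α<β = Injection.to (IsRegularCardinal.infinite β-regular) 0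
                 τ , τ∈T , _ = unbounded α α<β
             in τ , τ∈T

        -- The recursion runs over all of `K`, so `α < β` is made part of the relation: from `β` on
        -- nothing is demanded and `τ₀` serves.
        above : ∀ α (u : K → ∃ T) → ∃[ τ ] (∀ {ξ} → ξ < α × α < β → proj₁ (u ξ) < proj₁ τ)
        above α u with em {P = α < β}
        ... | yes α<β =
          let σ , σ<β , u<σ = regular⇒bounded β-regular α<β (λ ξ → proj₁ (u ξ))
                                (λ ξ _ → T⊆β (proj₂ (u ξ)))
              τ , τ∈T , σ≤τ = unbounded σ σ<β
          in (τ , τ∈T) , λ (ξ<α , _) → <-≤-trans (u<σ _ ξ<α) σ≤τ
        ... | no α≮β = τ₀ , λ (_ , α<β) → contradiction α<β α≮β

        sequence : Σ[ e ∈ (K → ∃ T) ] (∀ {ξ η} → ξ < η × η < β → proj₁ (e ξ) < proj₁ (e η))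
        sequence = monotoneMap ext {_⊏_ = λ σ τ → proj₁ σ < proj₁ τ}
                     (Subrelation.wellFounded proj₁ wellFounded) τ₀ above

        e = proj₁ sequence
        e-mono = proj₂ sequence

      small⇒bounded : ∣ T ∣ ≺ ∣ ↓ β ∣ → ∃[ α ] α < β × (∀ ξ → ξ ∈ T → ξ < α)
      small⇒bounded (_ , β⋠T) = byContradiction λ none →
        β⋠T (unbounded⇒≽ λ α α<β → byContradiction λ ∄τ →
          none (α , α<β , λ τ τ∈T → ≰⇒> λ α≤τ → ∄τ (τ , τ∈T , α≤τ)))

    -- Slaloms of width `b` and of width `id⁺`

    module _ (ext : ∀ {a b} → Extensionality a b) {b : K → K} (b∈R⁺ : R⁺ b) where

      open R⁺ b∈R⁺

      b-isCardinal : ∀ α → IsCardinal (↓ b α)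
      b-isCardinal α = IsRegularCardinal.isCardinal (regular α)

      dominating⇒antiLocalizing : ∀ 𝒢 → Dominating (∏ b) 𝒢 → AntiLocalizing b b 𝒢
      dominating⇒antiLocalizing 𝒢 (𝒢⊆∏b , dom) = 𝒢⊆∏b , λ φ φ∈Loc →
        let
          bound : ∀ α → ∃[ β ] β < b α × (∀ ξ → ξ ∈ φ α → ξ < β)
          bound α = small⇒bounded ext (regular α) (proj₁ (φ∈Loc α)) (proj₂ (φ∈Loc α))

          g , g∈𝒢 , α₀ , f≤g = dom (λ α → proj₁ (bound α)) (λ α → proj₁ (proj₂ (bound α)))
        in g , g∈𝒢 , α₀ , λ β α₀≤β gβ∈φβ →
             <⇒≱ (proj₂ (proj₂ (bound β)) (g β) gβ∈φβ) (f≤g β α₀≤β)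

      antiLocalizing⇒dominating : ∀ 𝒢 → AntiLocalizing b b 𝒢 → Dominating (∏ b) 𝒢
      antiLocalizing⇒dominating 𝒢 (𝒢⊆∏b , anti) = 𝒢⊆∏b , λ f f∈∏b →
        let g , g∈𝒢 , α₀ , g≮f =
              -- The predecessors of `f α` form a slalom of width `b`, because `b α` is a cardinal
              -- above `f α`. To avoid it is to be at least `f`.
              anti (λ α → ↓ f α) λ α →
                (λ ξ<fα → <-trans ξ<fα (f∈∏b α)) , initial-≺ (b-isCardinal α) (f∈∏b α)
        in g , g∈𝒢 , α₀ , λ β α₀≤β → ≮⇒≥ (g≮f β α₀≤β)

      -- `b α` is a cardinal above `α`, hence `id⁺ α ≤ b α`, and a slalom of width `id⁺` is also one
      -- of width `b`.
      antiLocalizing-id⁺ : ∀ {id⁺} → (∀ α → IsSuccessorCardinal α (id⁺ α)) →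
                           ∀ 𝒢 → AntiLocalizing b b 𝒢 → AntiLocalizing b id⁺ 𝒢
      antiLocalizing-id⁺ {id⁺} succ 𝒢 (𝒢⊆∏b , anti) = 𝒢⊆∏b , λ φ φ∈Loc →
        anti φ λ α →
          let
            φα⊆bα , φα≼id⁺α , id⁺α⋠φα = φ∈Loc α

            id⁺α≼bα : ∣ ↓ id⁺ α ∣ ≼ ∣ ↓ b α ∣
            id⁺α≼bα = initial-≼ (proj₂ (succ α) (b α) (b-isCardinal α)
                                  (initial-≺ (b-isCardinal α) (aboveId α)))
          in φα⊆bα , ≼-trans φα≼id⁺α id⁺α≼bα , λ bα≼φα → id⁺α⋠φα (≼-trans id⁺α≼bα bα≼φα)

    -- Successors, limits, closure points and pairing below κ

    module Inaccessible (inaccessible : IsStronglyInaccessible) (noMax : ∀ α → ∃[ β ] α < β) where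

      open IsStronglyInaccessible inaccessible

      next : K → K
      next α = proj₁ (least (noMax α))

      α<next : ∀ α → α < next α
      α<next α = proj₁ (proj₂ (least (noMax α)))

      <⇒next≤ : α < β → next α ≤ β
      <⇒next≤ {α} = proj₂ (proj₂ (least (noMax α))) _

      <next⇒≤ : α < next β → α ≤ β
      <next⇒≤ α<β⁺ = ≮⇒≥ λ β<α → <⇒≱ α<β⁺ (<⇒next≤ β<α)

      upper : ∀ α β → ∃[ γ ] α < γ × β < γ
      upper α β with compare α β
      ... | tri< α<β _ _  = next β , <-trans α<β (α<next β) , α<next β
      ... | tri≈ _ refl _ = next α , α<next α , α<next α
      ... | tri> _ _ β<α  = next α , α<next α , <-trans β<α (α<next α)

      bounded : ∀ α (f : K → K) → ∃[ β ] (∀ ξ → ξ < α → f ξ < β)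
      bounded α f = let β , _ , f<β = regular⇒bounded regular {α} _ f _ in β , f<β

      bounded₂ : ∀ α (f : K → K → K) → ∃[ β ] (∀ ξ η → ξ < α → η < α → f ξ η < β)
      bounded₂ α f =
        let β , rows<β = bounded α (λ ξ → proj₁ (bounded α (f ξ)))
        in β , λ ξ η ξ<α η<α → <-trans (proj₂ (bounded α (f ξ)) η η<α) (rows<β ξ ξ<α)

      iterate : K → ℕ → K
      iterate α ℕ.zero    = α
      iterate α (ℕ.suc n) = next (iterate α n)

      iterate-mono : ∀ α {m n} → m ℕ.<′ n → iterate α m < iterate α n
      iterate-mono α (ℕ.<′-base)     = α<next _
      iterate-mono α (ℕ.<′-step m<n) = <-trans (iterate-mono α m<n) (α<next _)

      iterate-injective : ∀ α {m n} → iterate α m ≡ iterate α n → m ≡ n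
      iterate-injective α {m} {n} eq with ℕₚ.<-cmp m n
      ... | tri< m<n _ _ = ⊥-elim (irrefl eq (iterate-mono α (ℕₚ.<⇒<′ m<n)))
      ... | tri≈ _ m≡n _ = m≡n
      ... | tri> _ _ n<m = ⊥-elim (irrefl (sym eq) (iterate-mono α (ℕₚ.<⇒<′ n<m)))

      IsLimit : Pred K ℓ
      IsLimit α = ∀ ξ → ξ < α → next ξ < α

      limit-infinite : IsLimit β → α < β → setoid ℕ ≼ ∣ ↓ β ∣
      limit-infinite {β} {α} lim α<β = record
        { to        = λ n → iterate α n , iterate<β n
        ; cong      = cong (iterate α)
        ; injective = iterate-injective α
        }
        where
        iterate<β : ∀ n → iterate α n < β
        iterate<β ℕ.zero    = α<β
        iterate<β (ℕ.suc n) = lim _ (iterate<β n)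

      private
        first : ∃[ α ] (∀ β → α ≤ β)
        first =
          let α₀ , _ = Injection.to (IsRegularCardinal.infinite regular) 0
              α , _ , α≤ = least {P = U} (α₀ , _)
          in α , λ β → α≤ β _

        0ᴷ : K
        0ᴷ = proj₁ first

      below-iterate : ∀ n {α} → α ≤ iterate 0ᴷ n → ∃[ m ] iterate 0ᴷ m ≡ α
      below-iterate ℕ.zero    α≤0 = 0 , ≤-antisym (proj₂ first _) α≤0
      below-iterate (ℕ.suc n) (inj₁ α<) = below-iterate n (<next⇒≤ α<)
      below-iterate (ℕ.suc n) (inj₂ eq) = ℕ.suc n , sym eq

      -- Otherwise every ordinal is at most some iterate of `next` on `0ᴷ`, hence by `below-iterate`
      -- is itself an iterate, and κ would be countable.
      ω-exists : ∃[ α ] (∀ n → iterate 0ᴷ n < α)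
      ω-exists = byContradiction λ none →
        let
          countable : ∣ U {A = K} ∣ ≼ ∣ U {A = ℕ} ∣
          countable = relation-≼ (λ α n → iterate 0ᴷ n ≡ α)
            (λ {α} _ →
              let n , α≤ = byContradiction λ ∄n → none (α , λ n → ≰⇒> λ α≤ → ∄n (n , α≤))
                  m , eq = below-iterate n α≤
              in m , _ , eq)
            λ where refl eq → eq
        in proj₂ uncountable (≼-trans countable
             (record { to = proj₁ ; cong = λ eq → eq ; injective = λ eq → eq }))

      -- Regularity speaks of maps on ordinals, so `u` is carried over to the iterates of `0ᴷ`,
      -- which lie below one ordinal. The values of `f` elsewhere are arbitrary.
      bounded-ω : ∀ (u : ℕ → K) → ∃[ β ] (∀ n → u n < β)
      bounded-ω u =
        let ω , iterate<ω = ω-exists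
            β , f<β       = bounded ω f
        in β , λ n → subst (_< β) (f-iterate n) (f<β _ (iterate<ω n))
        where
        f : K → K
        f α with em {P = ∃[ n ] iterate 0ᴷ n ≡ α}
        ... | yes (n , _) = u n
        ... | no _        = α

        f-iterate : ∀ n → f (iterate 0ᴷ n) ≡ u n
        f-iterate n with em {P = ∃[ m ] iterate 0ᴷ m ≡ iterate 0ᴷ n}
        ... | yes (m , eq) = cong u (iterate-injective 0ᴷ eq)
        ... | no ∄m        = contradiction (n , refl) ∄m

      ClosedUnder : (K → K) → Pred K ℓ
      ClosedUnder H δ = ∀ ξ → ξ < δ → H ξ < δ

      -- `δ` is the supremum of an ω-sequence in which each term bounds `H` on the ordinals below
      -- the previous term.
      closurePoint : ∀ (H : K → K) α → ∃[ δ ] α < δ × ClosedUnder H δ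
      closurePoint H α =
        let β , u<β = bounded-ω u
            δ , u≤δ , δ-least = least {P = λ δ → ∀ n → u n ≤ δ} (β , λ n → inj₁ (u<β n))
        in δ , <-≤-trans (α<next α) (u≤δ 0) , λ ξ ξ<δ →
             let n , ξ<u = byContradiction λ ∄n →
                             <⇒≱ ξ<δ (δ-least ξ λ n → ≮⇒≥ λ ξ<u → ∄n (n , ξ<u))
             in <-≤-trans (proj₂ (bounded (u n) H) ξ ξ<u) (u≤δ (ℕ.suc n))
        where
        u : ℕ → K
        u ℕ.zero    = next α
        u (ℕ.suc n) = proj₁ (bounded (u n) H)

      -- Zero is vacuously closed under every `H`, so it is excluded explicitly: `guess` needs some
      -- `ξ < δ` in order to get above `η`.
      closurePoints-club : ∀ (H : K → K) → IsClub (λ δ → (∃[ ξ ] ξ < δ) × ClosedUnder H δ)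
      closurePoints-club H = record
        { unbounded = λ ξ → let δ , ξ<δ , closed = closurePoint H ξ in δ , ξ<δ , (ξ , ξ<δ) , closed
        ; closed    = λ α nonzero limit → nonzero , λ ξ ξ<α →
            let η , ξ<η , η<α , _ , closed = limit ξ ξ<α in <-trans (closed ξ ξ<η) η<α
        }

      -- Pairs are well-ordered by an upper bound first, so that the pairs below a
      -- given one lie in a square of side less than κ.
      pairing : (∀ {a b} → Extensionality a b) →
                Σ[ ⟪_⟫ ∈ (K × K → K) ] (∀ {v w} → ⟪ v ⟫ ≡ ⟪ w ⟫ → v ≡ w)
      pairing ext = ⟪_⟫ , ⟪⟫-injective
        where
        key : K × K → K × (K × K)
        key (α , β) = proj₁ (upper α β) , α , β

        _≺ₖ_ : Rel (K × (K × K)) ℓ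
        _≺ₖ_ = ×-Lex _≡_ _<_ (×-Lex _≡_ _<_ _<_)

        _≺ₚ_ : Rel (K × K) ℓ
        v ≺ₚ w = key v ≺ₖ key w

        bound-≤ : ∀ {v w} → v ≺ₚ w → proj₁ (key v) ≤ proj₁ (key w)
        bound-≤ (inj₁ <w)       = inj₁ <w
        bound-≤ (inj₂ (eq , _)) = inj₂ eq

        above : ∀ w (u : K × K → K) → ∃[ β ] (∀ {v} → v ≺ₚ w → u v < β)
        above w u =
          let β , u<β = bounded₂ (proj₁ (key w)) (curry u)
          in β , λ { {ξ , η} v≺w →
               let _ , ξ<m , η<m = upper ξ η
               in u<β ξ η (<-≤-trans ξ<m (bound-≤ v≺w)) (<-≤-trans η<m (bound-≤ v≺w)) }

        sequence : Σ[ f ∈ (K × K → K) ] (∀ {v w} → v ≺ₚ w → f v < f w)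
        sequence = monotoneMap ext {_⊏_ = _<_}
          (On.wellFounded key (×-wellFounded wellFounded (×-wellFounded wellFounded wellFounded)))
          0ᴷ above

        ⟪_⟫ = proj₁ sequence
        ⟪⟫-mono = proj₂ sequence

        ⟪⟫-injective : ∀ {v w} → ⟪ v ⟫ ≡ ⟪ w ⟫ → v ≡ w
        ⟪⟫-injective {v} {w} eq
          with ×-compare sym compare (×-compare sym compare compare) (key v) (key w)
        ... | tri< v≺w _ _                 = ⊥-elim (irrefl eq (⟪⟫-mono v≺w))
        ... | tri≈ _ (_ , refl , refl) _ = refl
        ... | tri> _ _ w≺v                 = ⊥-elim (irrefl (sym eq) (⟪⟫-mono w≺v))

      -- Regressive addresses along a club of singular ordinals

      module SingularClub {C : Pred K ℓ} (C-club : IsClub C)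
                          (C-singular : ∀ α → α ∈ C → ¬ IsRegularCardinal (↓ α)) where

        C′ : Pred K ℓ
        C′ α = α ∈ C × IsLimit α

        bijection⇒cofinal : ∣ ↓ α ∣ ≈ ∣ ↓ β ∣ → ∃[ f ] Cofinal α (↓ β) f
        bijection⇒cofinal {α} {β} α≈β = f , f<β , λ η η<β →
            let (ξ , ξ<α) , to≡η = surjective (η , η<β)
            in ξ , ξ<α , inj₂ (sym (trans (f-to ξ<α) (to≡η refl)))
          where
          open Bijection α≈β using (to; surjective) renaming (cong to to-cong)

          f : K → K
          f ξ with em {P = ξ < α}
          ... | yes ξ<α = proj₁ (to (ξ , ξ<α))
          ... | no _    = ξ

          f-to : ∀ {ξ} (ξ<α : ξ < α) → f ξ ≡ proj₁ (to (ξ , ξ<α))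
          f-to {ξ} ξ<α with em {P = ξ < α}
          ... | yes _  = to-cong refl
          ... | no ξ≮α = contradiction ξ<α ξ≮α

          f<β : ∀ ξ → ξ < α → f ξ < β
          f<β ξ ξ<α = subst (_< β) (sym (f-to ξ<α)) (proj₂ (to (ξ , ξ<α)))

        -- Without such a map `δ` would be regular: it is infinite as a nonzero limit, and a
        -- bijection from a smaller ordinal is itself a cofinal map.
        singular-cofinal : ∀ {δ} → δ ∈ C′ → γ < δ →
                           ∃[ μ ] ∃[ f ] μ < δ × (∀ i → i < μ → f i < δ) ×
                                         (∀ β → β < δ → ∃[ i ] i < μ × β < f i)
        singular-cofinal {δ = δ} (δ∈C , lim) γ<δ =
          let
            μ , f , μ<δ , f<δ , cofinal = byContradiction λ none →
              C-singular δ δ∈C record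
                { infinite     = limit-infinite lim γ<δ
                ; isCardinal   = λ α α<δ α≈δ →
                    let f , cof = bijection⇒cofinal α≈δ in none (α , f , α<δ , cof)
                ; noCofinalMap = λ α α<δ f cof → none (α , f , α<δ , cof)
                }
          in μ , f , μ<δ , f<δ , λ β β<δ →
               -- Cofinality at `next β` instead of `β` yields the strict inequality.
               let i , i<μ , next≤f = cofinal (next β) (lim β β<δ)
               in i , i<μ , <-≤-trans (α<next β) next≤f

        Between : K → K → Pred K ℓ
        Between γ δ β = β ∈ C′ × γ < β × β < δ

        -- Makes β ↦ r regressive and at most |r|-to-one on the points of C′ between
        -- γ and δ; the second coordinate j < r enumerates the fibre over r.
        record Addressing (γ δ : K) : Set (Level.suc ℓ) where
          field
            Address   : K → K → K → Set ℓ
            total     : ∀ {β} → Between γ δ β → ∃[ r ] ∃[ j ] Address β r j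
            γ<r       : ∀ {β r j} → Address β r j → γ < r
            r<β       : ∀ {β r j} → Address β r j → r < β
            β<δ       : ∀ {β r j} → Address β r j → β < δ
            j<r       : ∀ {β r j} → Address β r j → j < r
            injective : ∀ {β β′ r j} → Address β r j → Address β′ r j → β ≡ β′

        open Addressing

        vacuous : ∀ {δ} → (∀ β → β ∉ Between γ δ) → Addressing γ δ
        vacuous none = record
          { Address   = λ _ _ _ → Lift ℓ ⊥
          ; total     = λ {β} between → contradiction between (none β)
          ; γ<r       = λ ()
          ; r<β       = λ ()
          ; β<δ       = λ ()
          ; j<r       = λ ()
          ; injective = λ ()
          }

        -- The fibre over γ + 1 is free for the point ξ, since elements of C′ are limits.
        split : ∀ {δ} → γ < ξ → ξ < δ → Addressing (next γ) ξ → Addressing ξ δ → Addressing γ δ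
        split {γ} {ξ} {δ} γ<ξ ξ<δ A B = record
          { Address = λ β r j → Address A β r j ⊎ AtSplit β r j ⊎ Address B β r j
          ; total   = total′
          ; γ<r = λ where
              (inj₁ a)                              → <-trans (α<next γ) (γ<r A a)
              (inj₂ (inj₁ (_ , _ , refl , _)))      → α<next γ
              (inj₂ (inj₂ b))                       → <-trans γ<ξ (γ<r B b)
          ; r<β = λ where
              (inj₁ a)                              → r<β A a
              (inj₂ (inj₁ (refl , <ξ , refl , _)))  → <ξ
              (inj₂ (inj₂ b))                       → r<β B b
          ; β<δ = λ where
              (inj₁ a)                              → <-trans (β<δ A a) ξ<δ
              (inj₂ (inj₁ (refl , _)))              → ξ<δ
              (inj₂ (inj₂ b))                       → β<δ B b
          ; j<r = λ where
              (inj₁ a)                              → j<r A a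
              (inj₂ (inj₁ (_ , _ , refl , refl)))   → α<next γ
              (inj₂ (inj₂ b))                       → j<r B b
          ; injective = λ where
              (inj₁ a) (inj₁ a′) → injective A a a′
              (inj₁ a) (inj₂ (inj₁ s)) → ⊥-elim (A-apart-split a s)
              (inj₁ a) (inj₂ (inj₂ b)) → ⊥-elim (A-apart-B a b)
              (inj₂ (inj₁ s)) (inj₁ a) → ⊥-elim (A-apart-split a s)
              (inj₂ (inj₁ (refl , _))) (inj₂ (inj₁ (refl , _))) → refl
              (inj₂ (inj₁ s)) (inj₂ (inj₂ b)) → ⊥-elim (split-apart-B s b)
              (inj₂ (inj₂ b)) (inj₁ a) → ⊥-elim (A-apart-B a b)
              (inj₂ (inj₂ b)) (inj₂ (inj₁ s)) → ⊥-elim (split-apart-B s b)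
              (inj₂ (inj₂ b)) (inj₂ (inj₂ b′)) → injective B b b′
          }
          where
          AtSplit : K → K → K → Set ℓ
          AtSplit β r j = β ≡ ξ × next γ < ξ × r ≡ next γ × j ≡ γ

          total′ : ∀ {β} → Between γ δ β → ∃[ r ] ∃[ j ] (Address A β r j ⊎ AtSplit β r j ⊎ Address B β r j)
          total′ {β} (β∈C′ , γ<β , β<δ) with compare β ξ
          ... | tri< β<ξ _ _ =
            let r , j , a = total A (β∈C′ , proj₂ β∈C′ γ γ<β , β<ξ) in r , j , inj₁ a
          ... | tri≈ _ refl _ = _ , _ , inj₂ (inj₁ (refl , proj₂ β∈C′ γ γ<β , refl , refl))
          ... | tri> _ _ ξ<β =
            let r , j , b = total B (β∈C′ , ξ<β , β<δ) in r , j , inj₂ (inj₂ b)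

          A-apart-split : ∀ {β β′ r j} → Address A β r j → ¬ AtSplit β′ r j
          A-apart-split a (_ , _ , refl , _) = irrefl refl (γ<r A a)

          A-apart-B : ∀ {β β′ r j} → Address A β r j → ¬ Address B β′ r j
          A-apart-B a b = irrefl refl (<-trans (γ<r B b) (<-trans (r<β A a) (β<δ A a)))

          split-apart-B : ∀ {β β′ r j} → AtSplit β r j → ¬ Address B β′ r j
          split-apart-B (_ , <ξ , refl , _) b = irrefl refl (<-trans (γ<r B b) <ξ)

        -- The points of the interval are cut into μ convex pieces, the piece i
        -- consisting of those β for which i is least with β < f i. The first point of
        -- the piece i gets the address (γ + 1, i).
        module Glue {γ δ μ : K} (f : K → K) (μ≤γ : μ ≤ γ) (f<δ : ∀ i → i < μ → f i < δ)
                    (cofinal : ∀ β → β < δ → ∃[ i ] i < μ × β < f i)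
                    (addressing : ∀ ξ → ξ < δ → ∀ γ → Addressing γ ξ) where

          Index : K → K → Set ℓ
          Index β i = (i < μ × β < f i) × (∀ j → j < μ × β < f j → i ≤ j)

          First : K → K → Set ℓ
          First σ i = (γ < σ × Index σ i) × (∀ β → γ < β × Index β i → σ ≤ β)

          -- `chosen` makes the addressing independent of the proof of `i < μ`, so that two
          -- addresses in the same piece can be compared.
          piece : ∀ σ i → i < μ → Addressing σ (f i)
          piece σ i i<μ = chosen (addressing (f i) (f<δ i i<μ) σ)

          AtFirst Within : K → K → K → Set ℓ
          AtFirst β r j = First β j × r ≡ next γ × next γ < β
          Within β r j =
            ∃[ σ ] ∃[ i ] Σ[ i<μ ∈ i < μ ] First σ i × Address (piece σ i i<μ) β r j

          index-unique : ∀ {β i i′} → Index β i → Index β i′ → i ≡ i′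
          index-unique (i∈ , i≤) (i′∈ , i′≤) = ≤-antisym (i≤ _ i′∈) (i′≤ _ i∈)

          first-unique : ∀ {σ σ′ i} → First σ i → First σ′ i → σ ≡ σ′
          first-unique (σ∈ , σ≤) (σ′∈ , σ′≤) = ≤-antisym (σ≤ _ σ′∈) (σ′≤ _ σ∈)

          -- The address alone determines its piece: `r` lies between the first point `σ` and `f i`,
          -- so it has the same index as `σ`. This separates the addresses of different pieces.
          within-index : ∀ {β σ i r j} (i<μ : i < μ) → First σ i →
                         Address (piece σ i i<μ) β r j → Index r i
          within-index {σ = σ} {i} i<μ ((_ , _ , i≤) , _) a =
              (i<μ , <-trans (r<β A a) (β<δ A a))
            , λ k (k<μ , r<fk) → i≤ k (k<μ , <-trans (γ<r A a) r<fk)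
            where A = piece σ i i<μ

          -- Keeps the addresses inside the pieces apart from those of the first points, which all
          -- lie over `next γ`.
          next<within : ∀ {β r j} → Within β r j → next γ < r
          next<within (σ , i , i<μ , ((γ<σ , _) , _) , a) =
            ≤-<-trans (<⇒next≤ γ<σ) (γ<r (piece σ i i<μ) a)

          within-injective : ∀ {β β′ r j} → Within β r j → Within β′ r j → β ≡ β′
          within-injective (σ , i , i<μ , first , a) (σ′ , i′ , i′<μ , first′ , a′)
            with index-unique (within-index i<μ first a) (within-index i′<μ first′ a′)
          ... | refl with first-unique first first′
          ... | refl = injective (piece σ i i<μ) a
                         (subst (λ A → Address A _ _ _) (chosen-constant _ _) a′)

          total′ : ∀ {β} → Between γ δ β → ∃[ r ] ∃[ j ] (AtFirst β r j ⊎ Within β r j)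
          total′ {β} (β∈C′ , γ<β , β<δ)
            with i , index ← least (cofinal β β<δ)
            with σ , first ← least {P = λ σ → γ < σ × Index σ i} (β , γ<β , index)
            with proj₂ first β (γ<β , index)
          ... | inj₂ refl = next γ , i , inj₁ (first , refl , proj₂ β∈C′ γ γ<β)
          ... | inj₁ σ<β =
            let i<μ , β<fi = proj₁ index
                r , j , a  = total (piece σ i i<μ) (β∈C′ , σ<β , β<fi)
            in r , j , inj₂ (σ , i , i<μ , first , a)

          glue : Addressing γ δ
          glue = record
            { Address = λ β r j → AtFirst β r j ⊎ Within β r j
            ; total   = total′
            ; γ<r = λ where
                (inj₁ (_ , refl , _)) → α<next γ
                (inj₂ w)              → <-trans (α<next γ) (next<within w)
            ; r<β = λ where
                (inj₁ (_ , refl , <β))          → <β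
                (inj₂ (σ , i , i<μ , first , a)) → r<β (piece σ i i<μ) a
            ; β<δ = λ where
                (inj₁ (((_ , (i<μ , β<fi) , _) , _) , _)) → <-trans β<fi (f<δ _ i<μ)
                (inj₂ (σ , i , i<μ , first , a)) → <-trans (β<δ (piece σ i i<μ) a) (f<δ i i<μ)
            ; j<r = λ where
                -- There are only `μ` pieces, and `μ ≤ γ` makes their indices fit below `next γ`.
                (inj₁ (((_ , (i<μ , _) , _) , _) , refl , _)) →
                  <-trans (<-≤-trans i<μ μ≤γ) (α<next γ)
                (inj₂ (σ , i , i<μ , first , a)) → j<r (piece σ i i<μ) a
            ; injective = λ where
                (inj₁ (first , _)) (inj₁ (first′ , _)) → first-unique first first′
                (inj₁ (_ , refl , _)) (inj₂ w) → ⊥-elim (irrefl refl (next<within w))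
                (inj₂ w) (inj₁ (_ , refl , _)) → ⊥-elim (irrefl refl (next<within w))
                (inj₂ w) (inj₂ w′) → within-injective w w′
            }

        -- If `C′` has no point between some `ξ < δ` and `δ`, splitting at `ξ` suffices. Otherwise
        -- `δ` is a limit of points of `C′`, so it lies in `C`, is singular, and the pieces given by
        -- a short cofinal map can be glued.
        addressing-step : ∀ δ → (∀ {ξ} → ξ < δ → ∀ γ → Addressing γ ξ) → ∀ γ → Addressing γ δ
        addressing-step δ IH γ with em {P = γ < δ}
        ... | no γ≮δ = vacuous λ β (_ , γ<β , β<δ) → γ≮δ (<-trans γ<β β<δ)
        ... | yes γ<δ with em {P = ∃[ ξ ] ξ < δ × (∀ β → β ∉ Between ξ δ)}
        ...   | yes (ξ , ξ<δ , none) = above-gap em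
          where
          above-gap : Dec (γ < ξ) → Addressing γ δ
          above-gap (yes γ<ξ) = split γ<ξ ξ<δ (IH ξ<δ (next γ)) (vacuous none)
          above-gap (no γ≮ξ)  = vacuous λ β (β∈C′ , γ<β , β<δ) →
            none β (β∈C′ , ≤-<-trans (≮⇒≥ γ≮ξ) γ<β , β<δ)
        ...   | no noGap = from-cofinal (singular-cofinal δ∈C′ γ<δ)
          where
          between : ∀ ξ → ξ < δ → ∃ (Between ξ δ)
          between ξ ξ<δ = byContradiction λ none → noGap (ξ , ξ<δ , λ β β∈ → none (β , β∈))

          δ∈C′ : δ ∈ C′
          δ∈C′ =
              IsClub.closed C-club δ (γ , γ<δ)
                (λ ξ ξ<δ → let η , (η∈C , _) , ξ<η , η<δ = between ξ ξ<δ in η , ξ<η , η<δ , η∈C)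
            , λ ξ ξ<δ → let η , _ , ξ<η , η<δ = between ξ ξ<δ in ≤-<-trans (<⇒next≤ ξ<η) η<δ

          from-cofinal : (∃[ μ ] ∃[ f ] μ < δ × (∀ i → i < μ → f i < δ) ×
                                       (∀ β → β < δ → ∃[ i ] i < μ × β < f i)) →
                         Addressing γ δ
          from-cofinal (μ , f , μ<δ , f<δ , cofinal) with em {P = γ < μ}
          -- Gluing needs a lower end of at least `μ`, so the part below `μ` is split off and left
          -- to the induction hypothesis.
          ... | yes γ<μ = split γ<μ μ<δ (IH μ<δ (next γ))
                            (Glue.glue f (inj₂ refl) f<δ cofinal (λ _ → IH))
          ... | no γ≮μ  = Glue.glue f (≮⇒≥ γ≮μ) f<δ cofinal (λ _ → IH)

        addressing : ∀ γ δ → Addressing γ δ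
        addressing γ δ = All.wfRec wellFounded _ (λ δ → ∀ γ → Addressing γ δ) addressing-step δ γ

        -- Guessing functions with ◇

        module Guessing (⟪_⟫ : K × K → K) (⟪⟫-injective : ∀ {v w} → ⟪ v ⟫ ≡ ⟪ w ⟫ → v ≡ w)
                        (◇ : Diamond) where

          private
            A = proj₁ ◇

          Graph : (K → K) → Pred K ℓ
          Graph g x = ∃[ ξ ] x ≡ ⟪ ξ , g ξ ⟫

          -- `A δ` need not code a function. The uniqueness clause ensures that `δ` contributes at
          -- most one value at `ξ`.
          Guessed : K → K → K → Set ℓ
          Guessed δ ξ η = ⟪ ξ , η ⟫ ∈ A δ × (∀ η′ → ⟪ ξ , η′ ⟫ ∈ A δ → η ≡ η′)

          IsGuess : (K → K) → Pred K ℓ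
          IsGuess g δ = δ ∈ C′ × (∀ ξ → ξ < δ → Guessed δ ξ (g ξ))

          guess : ∀ g η → ∃[ δ ] η < δ × IsGuess g δ
          guess g η =
            let
              δ , ((ξ , ξ<δ) , closed) , Graph⊆A , A⊆Graph =
                proj₂ (proj₂ ◇) (Graph g) _ (closurePoints-club H)

              below : ∀ {x} ξ → ξ < δ → x < H ξ → x < δ
              below ξ ξ<δ x<Hξ = <-trans x<Hξ (closed ξ ξ<δ)
            in δ , below ξ ξ<δ (η<H ξ) ,
               ( IsClub.closed C-club δ (ξ , ξ<δ)
                   (λ ξ ξ<δ → let ζ , ξ<ζ , ζ∈C = IsClub.unbounded C-club ξ
                              in ζ , ξ<ζ , below ξ ξ<δ (C<H ξ) , ζ∈C)
               , λ ξ ξ<δ → below ξ ξ<δ (next<H ξ)) ,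
               λ ξ ξ<δ →
                 Graph⊆A ((ξ , refl) , below ξ ξ<δ (code<H ξ)) ,
                 λ η′ ∈A → decode (proj₁ (A⊆Graph ∈A))
            where
            -- A nonzero `δ` closed under `H` is above `η`, is a limit ordinal and a limit of `C`,
            -- and contains the code of each pair in the graph of `g` below `δ`, so the set guessed
            -- there determines `g` below `δ`.
            H : K → K
            H ξ = proj₁ (upper (proj₁ (upper (proj₁ (IsClub.unbounded C-club ξ)) (next ξ)))
                               (proj₁ (upper ⟪ ξ , g ξ ⟫ η)))

            left : ∀ ξ → proj₁ (upper (proj₁ (IsClub.unbounded C-club ξ)) (next ξ)) < H ξ
            left ξ = proj₁ (proj₂ (upper _ _))

            right : ∀ ξ → proj₁ (upper ⟪ ξ , g ξ ⟫ η) < H ξ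
            right ξ = proj₂ (proj₂ (upper _ _))

            C<H : ∀ ξ → proj₁ (IsClub.unbounded C-club ξ) < H ξ
            C<H ξ = <-trans (proj₁ (proj₂ (upper _ _))) (left ξ)

            next<H : ∀ ξ → next ξ < H ξ
            next<H ξ = <-trans (proj₂ (proj₂ (upper _ _))) (left ξ)

            code<H : ∀ ξ → ⟪ ξ , g ξ ⟫ < H ξ
            code<H ξ = <-trans (proj₁ (proj₂ (upper _ _))) (right ξ)

            η<H : ∀ ξ → η < H ξ
            η<H ξ = <-trans (proj₂ (proj₂ (upper _ _))) (right ξ)

            decode : ∀ {ξ η′} → ⟪ ξ , η′ ⟫ ∈ Graph g → g ξ ≡ η′
            decode (ξ′ , eq) with ⟪⟫-injective eq
            ... | refl = refl

          guessAbove : (K → K) → K → K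
          guessAbove g η = proj₁ (guess g η)

          -- The slalom attached to `f`

          module _ (b f : K → K) where

            -- The intervals [lo α, hi α) partition κ, and f maps each of them below
            -- its upper end.
            private
              hi-point : ∀ α → ∃[ δ ] (α < δ × ClosedUnder f δ) ×
                                      (∀ ε → α < ε × ClosedUnder f ε → δ ≤ ε)
              hi-point α = least (closurePoint f α)

            hi : K → K
            hi α = proj₁ (hi-point α)

            α<hi : ∀ α → α < hi α
            α<hi α = proj₁ (proj₁ (proj₂ (hi-point α)))

            hi-closed : ∀ α → ClosedUnder f (hi α)
            hi-closed α = proj₂ (proj₁ (proj₂ (hi-point α)))

            hi-constant : α ≤ β → β < hi α → hi β ≡ hi α
            hi-constant {α} {β} α≤β β<hi = ≤-antisym
              (proj₂ (proj₂ (hi-point β)) _ (β<hi , hi-closed α))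
              (proj₂ (proj₂ (hi-point α)) _ (≤-<-trans α≤β (α<hi β) , hi-closed β))

            private
              lo-point : ∀ α → ∃[ γ ] hi γ ≡ hi α × (∀ ξ → hi ξ ≡ hi α → γ ≤ ξ)
              lo-point α = least (α , refl)

            lo : K → K
            lo α = proj₁ (lo-point α)

            hi-lo : ∀ α → hi (lo α) ≡ hi α
            hi-lo α = proj₁ (proj₂ (lo-point α))

            lo≤ : hi α ≡ hi β → lo β ≤ α
            lo≤ = proj₂ (proj₂ (lo-point _)) _

            lo-constant : hi α ≡ hi β → lo α ≡ lo β
            lo-constant {α} {β} eq =
              ≤-antisym (lo≤ (trans (hi-lo β) (sym eq))) (lo≤ (trans (hi-lo α) eq))

            -- If `lo β < α`, then `α` would lie in the interval of `β`, and `hi α` would be `hi β`,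
            -- which is above `β`. Hence all addresses used in the interval of `β` lie beyond `α`.
            ≤lo : hi α ≤ β → α ≤ lo β
            ≤lo {α} {β} hi≤β = ≮⇒≥ λ lo<α →
              let α<hi-lo = <-trans (<-≤-trans (α<hi α) hi≤β) (α<hi β)
                  hi≡     = hi-constant (inj₁ lo<α) (subst (α <_) (sym (hi-lo β)) α<hi-lo)
              in <⇒≱ (α<hi β) (subst (_≤ β) (trans hi≡ (hi-lo β)) hi≤β)

            Predicts : K → K → K → Set ℓ
            Predicts α η j =
              ∃[ δ ] Addressing.Address (addressing (lo α) (hi α)) δ α j × Guessed δ α η

            -- A value read off `A δ` may be too large, hence the cut at `b α`.
            slalom : K → Pred K ℓ
            slalom α η = η < b α × ∃ (Predicts α η)

            -- The coordinate `j < α` determines `δ` within the fibre over `α`, and `δ` determines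
            -- the guessed value.
            slalom-≼ : ∀ α → ∣ slalom α ∣ ≼ ∣ ↓ α ∣
            slalom-≼ α = relation-≼ (Predicts α)
              (λ (_ , j , predicts@(_ , a , _)) → j , Addressing.j<r block a , predicts)
              λ { (δ , a , _ , unique) (δ′ , a′ , ∈A , _) →
                  unique _ (subst (λ δ → _ ∈ A δ) (Addressing.injective block a′ a) ∈A) }
              where block = addressing (lo α) (hi α)

            slalom-∌⇒≤* : ∀ {g} → (∀ α → g α < b α) → slalom ∌^∞ g → f ≤* guessAbove g
            slalom-∌⇒≤* {g} g<b (α₀ , g∉) = hi α₀ , λ η hi≤η → ≮⇒≥ λ δ<fη →
              let
                δ , η<δ , δ∈C′ , guessed = guess g η
                block     = addressing (lo η) (hi η)
                lo≤η      = lo≤ {η} refl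
                δ<hi      = <-trans δ<fη (hi-closed η η (α<hi η))
                α , j , a = Addressing.total block (δ∈C′ , ≤-<-trans lo≤η η<δ , δ<hi)
                lo<α      = Addressing.γ<r block a
                α<δ       = Addressing.r<β block a
                hi≡       = trans (hi-constant (inj₁ lo<α)
                                    (subst (α <_) (sym (hi-lo η)) (<-trans α<δ δ<hi)))
                                  (hi-lo η)
              in g∉ α (≤-trans (≤lo hi≤η) (inj₁ lo<α))
                   (g<b α , j , δ ,
                    -- The address was found in the interval of `η`, whereas the slalom at `α`
                    -- refers to that of `α`. They coincide because `α` lies strictly between `lo η`
                    -- and `hi η`.
                    subst₂ (λ γ ε → Addressing.Address (addressing γ ε) δ α j)
                           (sym (lo-constant hi≡)) (sym hi≡) a ,
                    guessed α α<δ)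

          -- `guessAbove g` does not depend on `f`; only the slalom does. So the image of `𝒢` under
          -- `guessAbove` is a single family dominating every `f`.
          antiLocalizing⇒dominating-≼ :
            ∀ {b id⁺} → (∀ α → IsSuccessorCardinal α (id⁺ α)) →
            ∀ 𝒢 → AntiLocalizing b id⁺ 𝒢 → ∃[ ℋ ] Dominating U ℋ × ∣ ℋ ∣ ≼ ∣ 𝒢 ∣
          antiLocalizing⇒dominating-≼ {b} succ 𝒢 (𝒢⊆∏b , anti) =
            (λ h → ∃[ g ] g ∈ 𝒢 × guessAbove g ≡ h) ,
            (_ , λ f _ →
              let g , g∈𝒢 , φ∌g = anti (slalom b f) λ α →
                    let α≼id⁺ , id⁺⋠α = proj₂ (proj₁ (succ α))
                    in proj₁ , ≼-trans (slalom-≼ b f α) α≼id⁺ ,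
                       λ id⁺≼φ → id⁺⋠α (≼-trans id⁺≼φ (slalom-≼ b f α))
              in guessAbove g , (g , g∈𝒢 , refl) , slalom-∌⇒≤* b f (𝒢⊆∏b g∈𝒢) φ∌g) ,
            image-≼ guessAbove

-- The chain of inequalities

theorem2p7 : (∀ {a} → ExcludedMiddle a) →
    (∀ {a b} → Extensionality a b) →
    ∀ {ℓ} (κ : WellOrder ℓ) →
    let open OrdinalsBelow κ in
    IsStronglyInaccessible → ¬ IsMahlo → Diamond →
    ∀ (b : K → K) → R⁺ b →
    ∀ (id⁺ : K → K) → (∀ α → IsSuccessorCardinal α (id⁺ α)) →
    ∀ (𝔡₁ 𝔡₂ 𝔡₃ 𝔡₄ : Setoid ℓ ℓ) →
    Is𝔡≤* 𝔡₁ →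
    Is𝔡∌^∞ b id⁺ 𝔡₂ →
    Is𝔡∌^∞ b b 𝔡₃ →
    IsBounded𝔡≤* b 𝔡₄ →
    𝔡₁ ≼ 𝔡₂ × 𝔡₂ ≼ 𝔡₃ × 𝔡₃ ≈ 𝔡₄
theorem2p7 em ext κ inaccessible ¬mahlo ◇ b b∈R⁺ id⁺ succ 𝔡₁ 𝔡₂ 𝔡₃ 𝔡₄ least₁ least₂ least₃ least₄ =
    leastSize-≼ (antiLocalizing⇒dominating-≼ succ) least₂ least₁
  , leastSize-antitone (antiLocalizing-id⁺ ext b∈R⁺ succ) least₃ least₂
  , schröderBernstein
      (leastSize-antitone (dominating⇒antiLocalizing ext b∈R⁺) least₄ least₃)
      (leastSize-antitone (antiLocalizing⇒dominating ext b∈R⁺) least₃ least₄)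
  where
  open Classical em
  open Ordinals κ
  open OrdinalsBelow κ

  singularClub : ∃[ C ] IsClub C × (∀ α → α ∈ C → ¬ IsRegularCardinal (↓ α))
  -- As κ is inaccessible, failing to be Mahlo means that the regular ordinals are not stationary,
  -- so some club misses them.
  singularClub = byContradiction λ none → ¬mahlo
    (inaccessible , λ C C-club → byContradiction λ ∄α →
      none (C , C-club , λ α α∈C α-regular → ∄α (α , α∈C , α-regular)))

  -- `b` provides an ordinal above each `α`, so κ has no largest element.
  open Inaccessible inaccessible (λ α → b α , R⁺.aboveId b∈R⁺ α)
  open SingularClub (proj₁ (proj₂ singularClub)) (proj₂ (proj₂ singularClub))
  open Guessing (proj₁ (pairing ext)) (proj₂ (pairing ext)) ◇
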